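{- Let $k$ be a positive integer. In the game King, the Sprague-Grundy value of the staircase partition $[k,k-1,\ldots,1]$ equals $(k-1)\bmod 3$.
   Context: A partition is a finite weakly decreasing sequence $\lambda=[\lambda_1,\ldots,\lambda_r]$ of positive integers ($[\,]$ is the empty partition). For $i,j\ge 0$, $\lambda[i,j]=[\lambda_{i+1}-j,\lambda_{i+2}-j,\ldots]$ with trailing nonpositive entries removed. King is the impartial game whose positions are nonempty partitions; from $\mu$ a player may move to $\mu[a,b]$ for any $(a,b)\in\{(0,1),(1,0),(1,1)\}$ with $\mu[a,b]\ne[\,]$. The Sprague-Grundy value of a position is the mex (least nonnegative integer not in the set) of the Sprague-Grundy values of the positions reachable in one move (so $0$ for terminal positions). -}

module Defs where

open import Data.List.Base using (List; []; _∷_; map; mapMaybe; drop; filter; applyDownFrom)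
open import Data.List.Extrema.Nat using (max; xs≤max)
open import Data.List.Membership.DecPropositional using (_∈?_)
open import Data.List.Membership.Propositional using (_∈_; _∉_; mapWith∈)
open import Data.List.Membership.Propositional.Properties using (mapWith∈-cong; mapWith∈≗map)
open import Data.List.Relation.Unary.All as All using (All; []; _∷_)
import Data.List.Relation.Unary.All.Properties as All
open import Data.List.Relation.Unary.Linked as Linked using (Linked)
import Data.List.Relation.Unary.Linked.Properties as Linked
open import Data.Maybe.Base using (Maybe; just; nothing)
import Data.Maybe.Relation.Unary.All as Maybe
open import Data.Nat.Base
open import Data.Nat.Induction using (<-wellFounded)
open import Data.Nat.ListAction using (sum)
open import Data.Nat.Properties
open import Data.Product.Base using (_×_; _,_)
open import Data.Sum.Base using (inj₁; inj₂)
open import Function.Base using (_∘_)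
open import Induction.WellFounded using (WellFounded; Acc; acc; module Subrelation)
import Relation.Binary.Construct.On as On
open import Relation.Binary.PropositionalEquality
  using (_≡_; _≢_; refl; sym; trans; cong; subst)
open import Relation.Nullary using (yes; no; recompute; contradiction)

IsMex : List ℕ → ℕ → Set
IsMex xs n = n ∉ xs × (∀ {m} → m < n → m ∈ xs)

private
  search : List ℕ → ℕ → ℕ → ℕ
  search xs zero       n = n
  search xs (suc fuel) n with _∈?_ _≟_ n xs
  ... | yes _ = search xs fuel (suc n)
  ... | no  _ = n

  search-isMex : ∀ xs fuel n → max 0 xs < fuel + n →
                 (∀ {m} → m < n → m ∈ xs) → IsMex xs (search xs fuel n)
  search-isMex xs zero n max<n below =
    (λ n∈xs → <⇒≱ max<n (All.lookup (xs≤max 0 xs) n∈xs)) , below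
  search-isMex xs (suc fuel) n max<n below with _∈?_ _≟_ n xs
  ... | no n∉xs = n∉xs , below
  ... | yes n∈xs =
    search-isMex xs fuel (suc n) (subst (max 0 xs <_) (sym (+-suc fuel n)) max<n) below′
    where
    below′ : ∀ {m} → m < suc n → m ∈ xs
    below′ (s≤s m≤n) with m≤n⇒m<n∨m≡n m≤n
    ... | inj₁ m<n  = below m<n
    ... | inj₂ refl = n∈xs

mex : List ℕ → ℕ
mex xs = search xs (suc (max 0 xs)) 0

mex-isMex : ∀ xs → IsMex xs (mex xs)
mex-isMex xs = search-isMex xs (suc (max 0 xs)) 0 (s≤s (m≤m+n _ 0)) λ ()

record ImpartialGame : Set₁ where
  field
    Position    : Set
    options     : Position → List Position
    wellFounded : WellFounded λ q p → q ∈ options p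

module SpragueGrundy (G : ImpartialGame) where
  open ImpartialGame G

  private
    grundyAcc : ∀ p → Acc (λ q p → q ∈ options p) p → ℕ
    grundyAcc p (acc rs) = mex (mapWith∈ (options p) λ {q} q∈ → grundyAcc q (rs q∈))

    grundyAcc-irrelevant : ∀ p a b → grundyAcc p a ≡ grundyAcc p b
    grundyAcc-irrelevant p (acc rs) (acc ss) =
      cong mex (mapWith∈-cong (options p) _ _ λ {q} q∈ →
        grundyAcc-irrelevant q (rs q∈) (ss q∈))

  grundy : Position → ℕ
  grundy p = grundyAcc p (wellFounded p)

  grundy-unfold : ∀ p → grundy p ≡ mex (map grundy (options p))
  grundy-unfold p with wellFounded p
  ... | acc rs = cong mex (trans
    (mapWith∈-cong (options p) _ _ λ {q} q∈ → grundyAcc-irrelevant q (rs q∈) (wellFounded q))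
    (mapWith∈≗map grundy (options p)))

-- The proof fields are irrelevant, so partitions with equal parts are equal.
record Partition : Set where
  constructor partition
  field
    parts       : List ℕ
    .positive   : All (0 <_) parts
    .decreasing : Linked _≥_ parts

open Partition public using (parts)

-- `_∸ b` sends exactly the entries that would become nonpositive to 0; as the
-- list is weakly decreasing these are trailing, so filtering removes just them.
shiftParts : ℕ → ℕ → List ℕ → List ℕ
shiftParts a b xs = filter (0 <?_) (map (_∸ b) (drop a xs))

private
  drop-linked : ∀ a {xs} → Linked _≥_ xs → Linked _≥_ (drop a xs)
  drop-linked zero    l         = l
  drop-linked (suc a) Linked.[]  = Linked.[]
  drop-linked (suc a) Linked.[-] = drop-linked a Linked.[]
  drop-linked (suc a) (_ Linked.∷ l) = drop-linked a l

  shiftParts-positive : ∀ a b xs → All (0 <_) (shiftParts a b xs)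
  shiftParts-positive a b xs = All.all-filter (0 <?_) (map (_∸ b) (drop a xs))

  shiftParts-decreasing : ∀ a b {xs} → Linked _≥_ xs → Linked _≥_ (shiftParts a b xs)
  shiftParts-decreasing a b l =
    Linked.filter⁺ (0 <?_) (λ x≥y y≥z → ≤-trans y≥z x≥y)
      (Linked.map⁺ (Linked.map (∸-monoˡ-≤ b) (drop-linked a l)))

_[_,_] : Partition → ℕ → ℕ → Partition
partition xs p d [ a , b ] =
  partition (shiftParts a b xs) (shiftParts-positive a b xs) (shiftParts-decreasing a b d)

record Position : Set where
  constructor position
  field
    shape     : Partition
    .nonempty : parts shape ≢ []

open Position public using (shape)

asPosition : Partition → Maybe Position
asPosition   (partition []      _ _) = nothing
asPosition μ@(partition (_ ∷ _) _ _) = just (position μ λ ())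

steps : List (ℕ × ℕ)
steps = (0 , 1) ∷ (1 , 0) ∷ (1 , 1) ∷ []

kingOptions : Position → List Position
kingOptions μ = mapMaybe asPosition (map (λ (a , b) → shape μ [ a , b ]) steps)

private
  size : Partition → ℕ
  size = sum ∘ parts

  sum-filter-≤ : ∀ xs → sum (filter (0 <?_) xs) ≤ sum xs
  sum-filter-≤ []           = z≤n
  sum-filter-≤ (zero  ∷ xs) = sum-filter-≤ xs
  sum-filter-≤ (suc x ∷ xs) = +-monoʳ-≤ (suc x) (sum-filter-≤ xs)

  sum-map-≤ : ∀ b xs → sum (map (_∸ b) xs) ≤ sum xs
  sum-map-≤ b []       = z≤n
  sum-map-≤ b (x ∷ xs) = +-mono-≤ (m∸n≤m x b) (sum-map-≤ b xs)

  sum-shift-≤ : ∀ a b xs → sum (shiftParts a b xs) ≤ sum (map (_∸ b) (drop a xs))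
  sum-shift-≤ a b xs = sum-filter-≤ (map (_∸ b) (drop a xs))

  shift₀₁-< : ∀ {xs} → All (0 <_) xs → xs ≢ [] → sum (shiftParts 0 1 xs) < sum xs
  shift₀₁-< []                      xs≢[] = contradiction refl xs≢[]
  shift₀₁-< {suc x ∷ xs} (_ ∷ _) _ =
    ≤-<-trans (sum-shift-≤ 0 1 (suc x ∷ xs)) (+-mono-<-≤ (n<1+n x) (sum-map-≤ 1 xs))

  shift₁-< : ∀ b {xs} → All (0 <_) xs → xs ≢ [] → sum (shiftParts 1 b xs) < sum xs
  shift₁-< b []                xs≢[] = contradiction refl xs≢[]
  shift₁-< b {x ∷ xs} (0<x ∷ _) _ =
    ≤-<-trans (sum-shift-≤ 1 b (x ∷ xs)) (+-mono-<-≤ 0<x (sum-map-≤ b xs))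

  asPosition-size : ∀ {n} ν → size ν < n → Maybe.All (λ q → size (shape q) < n) (asPosition ν)
  asPosition-size (partition []      _ _) _ = Maybe.nothing
  asPosition-size (partition (_ ∷ _) _ _) h = Maybe.just h

  options-smaller : ∀ μ → All (λ ν → size (shape ν) < size (shape μ)) (kingOptions μ)
  options-smaller (position μ@(partition xs p _) ne) = All.mapMaybe⁺ {f = asPosition}
    ( asPosition-size (μ [ 0 , 1 ]) (recompute (_ <? _) (shift₀₁-< p ne))
    ∷ asPosition-size (μ [ 1 , 0 ]) (recompute (_ <? _) (shift₁-< 0 p ne))
    ∷ asPosition-size (μ [ 1 , 1 ]) (recompute (_ <? _) (shift₁-< 1 p ne))
    ∷ [])

king : ImpartialGame
king = record
  { Position    = Position
  ; options     = kingOptions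
  ; wellFounded = Subrelation.wellFounded (λ {q} {p} → All.lookup (options-smaller p))
                    (On.wellFounded (size ∘ shape) <-wellFounded)
  }

-- `applyDownFrom suc k` is k ∷ k ∸ 1 ∷ … ∷ 1 ∷ [].
staircase : ℕ → Partition
staircase k = partition (applyDownFrom suc k)
  (All.applyDownFrom⁺₂ suc k λ _ → z<s)
  (Linked.applyDownFrom⁺₂ suc k descending)
  where
  descending : ∀ i → suc (suc i) ≥ suc i
  descending i = n≤1+n (suc i)

staircasePosition : ∀ k .{{_ : NonZero k}} → Position
staircasePosition (suc k) = position (staircase (suc k)) λ ()

{-# OPTIONS --safe #-}
module Submission where

open import Data.List.Base using ([]; _∷_; map; mapMaybe; applyDownFrom)
open import Data.Nat using (ℕ; zero; suc; NonZero; _∸_; _%_)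
open import Relation.Binary.PropositionalEquality
  using (_≡_; refl; trans; cong; cong₂)
open import Defs

-- Each of the moves (0,1) and (1,0) shortens the staircase by one step and
-- (1,1) shortens it by two, so g(k) = mex {g(k−1), g(k−2)} for k ≥ 3, where g is
-- the value of the staircase with k steps. From g(1) = 0 and g(2) = 1 on, this
-- recursion cycles through 0, 1, 2.

-- `suc (suc (suc n)) % 3` reduces to `n % 3`, so three closed cases decide everything.
mex-%3 : ∀ n → mex (suc n % 3 ∷ suc n % 3 ∷ n % 3 ∷ []) ≡ suc (suc n) % 3
mex-%3 0 = refl
mex-%3 1 = refl
mex-%3 2 = refl
mex-%3 (suc (suc (suc n))) = mex-%3 n

module _ (G : ImpartialGame) where
  open ImpartialGame G using (options)
  open SpragueGrundy G

  grundy-sequence : (p : ℕ → ImpartialGame.Position G) →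
    options (p 0) ≡ [] →
    options (p 1) ≡ p 0 ∷ p 0 ∷ [] →
    (∀ n → options (p (suc (suc n))) ≡ p (suc n) ∷ p (suc n) ∷ p n ∷ []) →
    ∀ n → grundy (p n) ≡ n % 3
  grundy-sequence p opts₀ opts₁ opts₂ = value
    where
    unfold : ∀ q {qs} → options q ≡ qs → grundy q ≡ mex (map grundy qs)
    unfold q refl = grundy-unfold q

    value : ∀ n → grundy (p n) ≡ n % 3
    value 0 = unfold (p 0) opts₀
    value 1 = trans (unfold (p 1) opts₁)
      (cong (λ g → mex (g ∷ g ∷ [])) (value 0))
    value (suc (suc n)) = trans (unfold (p (suc (suc n))) (opts₂ n))
      (trans (cong₂ (λ g h → mex (g ∷ g ∷ h ∷ [])) (value (suc n)) (value n))
             (mex-%3 n))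

parts-injective : ∀ {μ ν} → parts μ ≡ parts ν → μ ≡ ν
parts-injective {partition _ _ _} {partition _ _ _} refl = refl

-- The last part, 1, drops to 0 and is filtered out; every other part becomes the next one down.
shiftParts₀₁-staircase : ∀ n →
  shiftParts 0 1 (applyDownFrom suc (suc n)) ≡ applyDownFrom suc n
shiftParts₀₁-staircase zero    = refl
shiftParts₀₁-staircase (suc n) = cong (suc n ∷_) (shiftParts₀₁-staircase n)

-- What is left of the move (1,0) once `drop` has computed: subtracting 0 and filtering change
-- nothing.
shiftParts₀₀-staircase : ∀ n →
  shiftParts 0 0 (applyDownFrom suc n) ≡ applyDownFrom suc n
shiftParts₀₀-staircase zero    = refl
shiftParts₀₀-staircase (suc n) = cong (suc n ∷_) (shiftParts₀₀-staircase n)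

staircase[0,1] : ∀ n → staircase (suc n) [ 0 , 1 ] ≡ staircase n
staircase[0,1] n = parts-injective (shiftParts₀₁-staircase n)

staircase[1,0] : ∀ n → staircase (suc n) [ 1 , 0 ] ≡ staircase n
staircase[1,0] n = parts-injective (shiftParts₀₀-staircase n)

staircase[1,1] : ∀ n → staircase (suc (suc n)) [ 1 , 1 ] ≡ staircase n
staircase[1,1] n = parts-injective (shiftParts₀₁-staircase n)

-- `mapMaybe asPosition` stays on the right because `staircase n` is an option only for positive
-- `n`.
kingOptions-staircase : ∀ n → kingOptions (staircasePosition (suc (suc n))) ≡
  mapMaybe asPosition (staircase (suc n) ∷ staircase (suc n) ∷ staircase n ∷ [])
kingOptions-staircase n = cong (mapMaybe asPosition)
  (cong₂ _∷_ (staircase[0,1] (suc n))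
    (cong₂ _∷_ (staircase[1,0] (suc n))
      (cong (_∷ []) (staircase[1,1] n))))

lemma3p13 : (k : ℕ) .{{_ : NonZero k}} →
    SpragueGrundy.grundy king (staircasePosition k) ≡ (k ∸ 1) % 3
lemma3p13 (suc n) = grundy-sequence king (λ m → staircasePosition (suc m))
  -- From one step every move leads to the empty partition, hence `refl`; from two steps only (1,1)
  -- does, leaving two equal options.
  refl (kingOptions-staircase 0) (λ m → kingOptions-staircase (suc m)) n
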